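{- Deciding whether a given HyperLTL formula $\varphi$ defines a hypersafety property is $\Pi^1_1$-hard.
   Context: Fix a finite set $\mathit{AP}$ of atomic propositions and $\Sigma=2^{\mathit{AP}}$; traces are elements of $\Sigma^\omega$. HyperLTL: $\varphi ::= \exists\pi\mathpunct{.}\varphi \mid \forall\pi\mathpunct{.}\varphi \mid \phi$, $\phi ::= a_\pi \mid \neg\phi\mid\phi\wedge\phi\mid\mathsf{X}\phi\mid\phi\,\mathsf{U}\,\phi$ (closed); semantics w.r.t. a set of traces $T$ as usual (quantifiers range over $T$, temporal operators shift all bound traces synchronously); $\varphi$ defines the hyperproperty $\{T\subseteq\Sigma^\omega\mid T\models\varphi\}$. For finite $u\in\Sigma^*$ and $t\in\Sigma^\omega$, $u\lessdot t$ means $u$ is a prefix of $t$; for $U\subseteq\Sigma^*$ and $T\subseteq\Sigma^\omega$, $U\lessdot T$ means every $u\in U$ is a prefix of some $t\in T$. A hyperproperty $H$ (set of sets of traces) is hypersafety if for every $T\subseteq\Sigma^\omega$ with $T\notin H$ there is a finite set $U\subseteq\Sigma^*$ with $U\lessdot T$ such that every $T'\subseteq\Sigma^\omega$ with $U\lessdot T'$ satisfies $T'\notin H$. -}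

module Defs where

open import Data.Nat using (ℕ; zero; suc; _≤_; _<_)
open import Data.Fin using (Fin; zero; suc)
open import Data.Bool using (Bool; true; false)
open import Data.Vec using (Vec; lookup; _∷_)
open import Data.List using (List; []; _∷_)
open import Data.List.Relation.Unary.All using (All)
open import Data.Product using (Σ; ∃; _×_; _,_; proj₁)
open import Data.Unit using (⊤)
open import Relation.Nullary using (¬_)
open import Relation.Binary.PropositionalEquality using (_≡_)


-- Traces over AP = Fin n.  A letter (element of Σ = 2^AP) is a
-- Boolean vector of length n (its characteristic vector).

Letter : ℕ → Set
Letter n = Vec Bool n

Trace : ℕ → Set
Trace n = ℕ → Letter n

Word : ℕ → Set
Word n = List (Letter n)

TraceSet : ℕ → Set₁
TraceSet n = Trace n → Set

HyperProperty : ℕ → Set₁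
HyperProperty n = TraceSet n → Set

-- HyperLTL syntax (trace variables as de Bruijn indices, k = number of
-- trace variables in scope).

data Body (n k : ℕ) : Set where
  ap    : Fin n → Fin k → Body n k
  neg   : Body n k → Body n k
  and   : Body n k → Body n k → Body n k
  next  : Body n k → Body n k
  until : Body n k → Body n k → Body n k

data HForm (n : ℕ) : ℕ → Set where
  ∃π    : ∀ {k} → HForm n (suc k) → HForm n k
  ∀π    : ∀ {k} → HForm n (suc k) → HForm n k
  body  : ∀ {k} → Body n k → HForm n k

Closed : ℕ → Set
Closed n = HForm n 0

Assignment : ℕ → ℕ → Set
Assignment n k = Fin k → Trace n

extend : ∀ {n k} → Trace n → Assignment n k → Assignment n (suc k)
extend t Π zero    = t
extend t Π (suc x) = Π x

⟦_⟧ᴮ : ∀ {n k} → Body n k → Assignment n k → ℕ → Set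
⟦ ap a π ⟧ᴮ Π i    = lookup (Π π i) a ≡ true
⟦ neg φ ⟧ᴮ Π i     = ¬ (⟦ φ ⟧ᴮ Π i)
⟦ and φ ψ ⟧ᴮ Π i   = ⟦ φ ⟧ᴮ Π i × ⟦ ψ ⟧ᴮ Π i
⟦ next φ ⟧ᴮ Π i    = ⟦ φ ⟧ᴮ Π (suc i)
⟦ until φ ψ ⟧ᴮ Π i =
  Σ ℕ λ j → i ≤ j × ⟦ ψ ⟧ᴮ Π j × (∀ m → i ≤ m → m < j → ⟦ φ ⟧ᴮ Π m)

Sat : ∀ {n k} → TraceSet n → HForm n k → Assignment n k → Set
Sat T (∃π φ)  Π = Σ (Trace _) λ t → T t × Sat T φ (extend t Π)
Sat T (∀π φ)  Π = (t : Trace _) → T t → Sat T φ (extend t Π)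
Sat T (body φ) Π = ⟦ φ ⟧ᴮ Π 0

emptyAssignment : ∀ {n} → Assignment n 0
emptyAssignment ()

_⊨_ : ∀ {n} → TraceSet n → Closed n → Set
T ⊨ φ = Sat T φ emptyAssignment

⟪_⟫ : ∀ {n} → Closed n → HyperProperty n
⟪ φ ⟫ T = T ⊨ φ

_⋖_ : ∀ {n} → Word n → Trace n → Set
[]      ⋖ t = ⊤
(a ∷ u) ⋖ t = (a ≡ t 0) × (u ⋖ (λ i → t (suc i)))

-- U ⋖ T for a finite set U of finite words (given as a list)
_⋖ˢ_ : ∀ {n} → List (Word n) → TraceSet n → Set
U ⋖ˢ T = All (λ u → Σ (Trace _) λ t → T t × u ⋖ t) U

IsHypersafety : ∀ {n} → HyperProperty n → Set₁
IsHypersafety {n} H =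
  (T : TraceSet n) → ¬ H T →
  Σ (List (Word n)) λ U → (U ⋖ˢ T) × ((T′ : TraceSet n) → U ⋖ˢ T′ → ¬ H T′)

-- decision problem: a HyperLTL formula (over AP = Fin n, n part of the
-- input) that defines a hypersafety property
HyperLTLFormula : Set
HyperLTLFormula = Σ ℕ Closed

DefinesHypersafety : HyperLTLFormula → Set₁
DefinesHypersafety (n , φ) = IsHypersafety ⟪ φ ⟫

-- A canonical Π¹₁-complete problem: non-recurrence of nondeterministic
-- two-counter machines (the recurrence problem -- is there an infinite
-- run from the initial configuration visiting instruction 0 infinitely
-- often -- is Σ¹₁-complete, Alur & Henzinger 1994).

data Instr (m : ℕ) : Set where
  inc : Fin 2 → Fin m → Fin m → Instr m
    -- increment counter c, then go nondeterministically to j or k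
  jzdec : Fin 2 → Fin m → Fin m → Instr m
    -- if counter c is 0 go to j, else decrement c and go to k

record Machine : Set where
  constructor machine
  field
    size    : ℕ
    program : Vec (Instr (suc size)) (suc size)
open Machine public

Counters : Set
Counters = ℕ × ℕ

getC : Fin 2 → Counters → ℕ
getC zero    (x , y) = x
getC (suc _) (x , y) = y

setC : Fin 2 → ℕ → Counters → Counters
setC zero    v (x , y) = (v , y)
setC (suc _) v (x , y) = (x , v)

Config : Machine → Set
Config M = Fin (suc (size M)) × Counters

data StepI {m : ℕ} : Instr m → Fin m × Counters → Fin m × Counters → Set where
  inc-j : ∀ {l c j k cs} → StepI (inc c j k) (l , cs) (j , setC c (suc (getC c cs)) cs)
  inc-k : ∀ {l c j k cs} → StepI (inc c j k) (l , cs) (k , setC c (suc (getC c cs)) cs)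
  jz    : ∀ {l c j k cs} → getC c cs ≡ 0 → StepI (jzdec c j k) (l , cs) (j , cs)
  dec   : ∀ {l c j k cs v} → getC c cs ≡ suc v →
          StepI (jzdec c j k) (l , cs) (k , setC c v cs)

Step : (M : Machine) → Config M → Config M → Set
Step M (l , cs) cfg′ = StepI (lookup (program M) l) (l , cs) cfg′

initial : (M : Machine) → Config M
initial M = (zero , (0 , 0))

Recurring : Machine → Set
Recurring M =
  Σ (ℕ → Config M) λ r →
    (r 0 ≡ initial M) ×
    (∀ i → Step M (r i) (r (suc i))) ×
    (∀ i → Σ ℕ λ j → i ≤ j × proj₁ (r j) ≡ zero)

NonRecurring : Machine → Set
NonRecurring M = ¬ Recurring M

-- Π¹₁-hardness of a predicate P on HyperLTL formulas: a computable
-- many-one reduction (an Agda function) from the Π¹₁-complete problem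
-- NonRecurring.

Π¹₁-hard : (HyperLTLFormula → Set₁) → Set₁
Π¹₁-hard P =
  Σ (Machine → HyperLTLFormula) λ f →
    ∀ M → (NonRecurring M → P (f M)) × (P (f M) → NonRecurring M)

{-# OPTIONS --safe #-}
-- A configuration of M, together with a countdown d, is encoded in a trace: each counter value and
-- d is the first position at which its proposition holds, and the instruction label is one-hot at
-- position 0.  In φ = ∃π₀ ∃πᶠ ∀π ∃π′ Φ, the formula Φ makes π₀ encode the initial configuration and
-- πᶠ carry a flag, and gives every trace π a successor π′ in the set that encodes a next
-- configuration whose countdown is one smaller, unless it is zero, which is allowed only at
-- label 0 and lets the countdown restart.
-- Following successors from π₀ thus yields a run visiting label 0 infinitely often.  So if M is
-- not recurring, no set of traces satisfies φ, and ⟪ φ ⟫ is trivially hypersafety.  If M is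
-- recurring, the unflagged encodings of a recurring run violate φ, but adding one flagged trace
-- yields a model of φ; since hypersafety properties are subset-closed, ⟪ φ ⟫ is not hypersafety.
module Submission where

open import Defs
open import Data.Bool using (Bool; true; false)
import Data.Bool.Properties as Bool
open import Data.Fin using (Fin; zero; suc)
import Data.Fin.Properties as Fin
open import Data.Fin.Properties using (any?)
open import Data.List using (List; []; _∷_)
open import Data.List.Membership.Propositional using (_∈_)
open import Data.List.Relation.Unary.Any using (here; there)
import Data.List.Relation.Unary.All as All
open import Data.Nat using (ℕ; zero; suc; _≤_; _<_; _+_; _∸_; z≤n; s≤s)
import Data.Nat.Properties as ℕ
open import Data.Product using (Σ; ∃; _×_; _,_; proj₁; proj₂)
open import Data.Product.Properties using (≡-dec)
open import Data.Sum using (inj₁; inj₂)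
open import Data.Vec using (_∷_; lookup; tabulate)
open import Data.Vec.Properties using (lookup∘tabulate)
open import Function using (_∘_)
open import Function.Bundles using (_⇔_; mk⇔; Equivalence)
open import Function.Construct.Composition using (_⇔-∘_)
open import Function.Construct.Identity using (⇔-id)
open import Function.Construct.Symmetry using (⇔-sym)
open import Relation.Binary using (Decidable; tri<; tri≈; tri>)
open import Relation.Binary.PropositionalEquality
open import Relation.Nullary using (¬_; Dec; yes; no; does)
open import Relation.Nullary.Decidable using (decidable-stable; dec-true; dec-false; map′)
open import Relation.Nullary.Negation using (Stable; negated-stable; contradiction; ¬¬-map)
open import Relation.Unary using (_⊆_; _∪_; ｛_｝)

open Equivalence using (to; from)

First : (ℕ → Bool) → ℕ → Set
First f j = f j ≡ true × (∀ {i} → i < j → f i ≢ true)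

First-unique : ∀ {f i j} → First f i → First f j → i ≡ j
First-unique {i = i} {j} (fi , <i) (fj , <j) with ℕ.<-cmp i j
... | tri< i<j _ _ = contradiction fi (<j i<j)
... | tri≈ _ i≡j _ = i≡j
... | tri> _ _ j<i = contradiction fj (<i j<i)

First-resp-≗ : ∀ {f g j} → f ≗ g → First f j → First g j
First-resp-≗ f≗g (fj , <j) = trans (sym (f≗g _)) fj , λ i<j → <j i<j ∘ trans (f≗g _)

First-zero : ∀ {f} → f 0 ≡ true → First f 0
First-zero f0 = f0 , λ ()

First-suc : ∀ {f j} → f 0 ≢ true → First (f ∘ suc) j → First f (suc j)
First-suc f0 (fj , <j) = fj , λ { {zero} _ → f0 ; {suc i} (s≤s i<j) → <j i<j }

First-shift : ∀ {f g v w} → f 0 ≢ true → f ∘ suc ≗ g → First f v → First g w → v ≡ suc w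
First-shift f0 shift fv gw = First-unique fv (First-suc f0 (First-resp-≗ (sym ∘ shift) gw))

unary : ℕ → ℕ → Bool
unary v i = does (i ℕ.≟ v)

First-unary : ∀ v → First (unary v) v
First-unary v = dec-true (v ℕ.≟ v) refl , λ i<v → Bool.not-¬ (dec-false (_ ℕ.≟ v) (ℕ.<⇒≢ i<v))

CountsDown : Set → ℕ → ℕ → Set
CountsDown P zero    _  = P
CountsDown P (suc d) d′ = d′ ≡ d

CountsDown? : ∀ {P} → Dec P → ∀ d d′ → Dec (CountsDown P d d′)
CountsDown? P? zero    _  = P?
CountsDown? P? (suc d) d′ = d′ ℕ.≟ d

Countdown : (ℕ → Set) → (ℕ → ℕ) → Set
Countdown P c = ∀ i → CountsDown (P i) (c i) (c (suc i))

InfinitelyOften : (ℕ → Set) → Set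
InfinitelyOften P = ∀ i → ∃ λ j → i ≤ j × P j

module _ {P : ℕ → Set} where

  countdown⇒infinitelyOften : ∀ {c} → Countdown P c → InfinitelyOften P
  countdown⇒infinitelyOften {c} counts i = i + c i , ℕ.m≤m+n i (c i) , reach (c i) i refl
    where
      reach : ∀ d i → c i ≡ d → P (i + d)
      reach zero i ci≡0 =
        subst P (sym (ℕ.+-identityʳ i)) (subst (λ d → CountsDown (P i) d (c (suc i))) ci≡0 (counts i))
      reach (suc d) i ci≡1+d = subst P (sym (ℕ.+-suc i d))
        (reach d (suc i) (subst (λ d → CountsDown (P i) d (c (suc i))) ci≡1+d (counts i)))

  infinitelyOften⇒countdown : InfinitelyOften P → ∃ (Countdown P)
  infinitelyOften⇒countdown often = countdown , counts
    where
      gap : ℕ → ℕ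
      gap i = proj₁ (often i) ∸ i

      gap-reaches : ∀ i → P (i + gap i)
      gap-reaches i = let (_ , i≤j , Pj) = often i in subst P (sym (ℕ.m+[n∸m]≡n i≤j)) Pj

      tick : ℕ → ℕ → ℕ
      tick i zero    = gap i
      tick i (suc d) = d

      countdown : ℕ → ℕ
      countdown zero    = gap zero
      countdown (suc i) = tick (suc i) (countdown i)

      reaches : ∀ i → P (i + countdown i)
      reaches zero    = gap-reaches zero
      reaches (suc i) = tick-reaches (countdown i) (reaches i)
        where
          tick-reaches : ∀ d → P (i + d) → P (suc i + tick (suc i) d)
          tick-reaches zero    _ = gap-reaches (suc i)
          tick-reaches (suc d) p = subst P (ℕ.+-suc i d) p

      counts : Countdown P countdown
      counts i with countdown i | reaches i
      ... | zero  | p = subst P (ℕ.+-identityʳ i) p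
      ... | suc d | _ = refl

otherC : Fin 2 → Fin 2
otherC zero    = suc zero
otherC (suc _) = zero

getC-setC : ∀ c v cs → getC c (setC c v cs) ≡ v
getC-setC zero    v _ = refl
getC-setC (suc _) v _ = refl

getC-otherC-setC : ∀ c v cs → getC (otherC c) (setC c v cs) ≡ getC (otherC c) cs
getC-otherC-setC zero    v _ = refl
getC-otherC-setC (suc _) v _ = refl

getC-ext : ∀ c {cs cs′} → getC c cs′ ≡ getC c cs → getC (otherC c) cs′ ≡ getC (otherC c) cs → cs′ ≡ cs
getC-ext zero    refl refl = refl
getC-ext (suc _) refl refl = refl

setC-unique : ∀ c {v cs cs′} → getC c cs′ ≡ v → getC (otherC c) cs′ ≡ getC (otherC c) cs →
              cs′ ≡ setC c v cs
setC-unique c {v} {cs} c≡v other≡ =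
  getC-ext c (trans c≡v (sym (getC-setC c v cs))) (trans other≡ (sym (getC-otherC-setC c v cs)))

module _ {m : ℕ} where

  successors : Instr m → Fin m × Counters → List (Fin m × Counters)
  successors (inc c j k) (_ , cs) = (j , cs′) ∷ (k , cs′) ∷ []
    where cs′ = setC c (suc (getC c cs)) cs
  successors (jzdec c j k) (_ , cs) with getC c cs
  ... | zero  = (j , cs) ∷ []
  ... | suc v = (k , setC c v cs) ∷ []

  StepI⇒∈successors : ∀ {ins a b} → StepI ins a b → b ∈ successors ins a
  StepI⇒∈successors inc-j = here refl
  StepI⇒∈successors inc-k = there (here refl)
  StepI⇒∈successors (jz c≡0) rewrite c≡0 = here refl
  StepI⇒∈successors (dec c≡1+v) rewrite c≡1+v = here refl

  ∈successors⇒StepI : ∀ ins {a b} → b ∈ successors ins a → StepI ins a b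
  ∈successors⇒StepI (inc c j k) (here refl)         = inc-j
  ∈successors⇒StepI (inc c j k) (there (here refl)) = inc-k
  ∈successors⇒StepI (jzdec c j k) {_ , cs} b∈ with getC c cs in c≡ | b∈
  ... | zero  | here refl = jz c≡
  ... | suc _ | here refl = dec c≡

  StepI? : ∀ ins → Decidable (StepI ins)
  StepI? ins a b = map′ (∈successors⇒StepI ins) StepI⇒∈successors (b ∈? successors ins a)
    where open import Data.List.Membership.DecPropositional (≡-dec Fin._≟_ (≡-dec ℕ._≟_ ℕ._≟_))

  StepI-stable : ∀ ins a b → Stable (StepI ins a b)
  StepI-stable ins a b = decidable-stable (StepI? ins a b)

bit : ∀ {n} → Trace n → Fin n → ℕ → Bool
bit t a i = lookup (t i) a

module _ {n k : ℕ} where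

  or iff : Body n k → Body n k → Body n k
  or A B  = neg (and (neg A) (neg B))
  iff A B = and (neg (and A (neg B))) (neg (and B (neg A)))

  -- ¬ (A ∧ ¬ A) plays the role of ⊤, which needs no atomic proposition.
  always : Body n k → Body n k
  always A = neg (until (neg (and A (neg A))) (neg A))

  literal : Bool → Body n k → Body n k
  literal true  A = A
  literal false A = neg A

  ⋀ ⋁ : ∀ {m} → (Fin (suc m) → Body n k) → Body n k
  ⋀ {zero}  f = f zero
  ⋀ {suc m} f = and (f zero) (⋀ (f ∘ suc))
  ⋁ {zero}  f = f zero
  ⋁ {suc m} f = or (f zero) (⋁ (f ∘ suc))

-- ⟦ or A B ⟧ᴮ Π i unfolds to ¬ (¬ ⟦ A ⟧ᴮ Π i × ¬ ⟦ B ⟧ᴮ Π i); stating the next three lemmas for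
-- that shape lets Agda infer the disjuncts, which it cannot recover from ⟦_⟧ᴮ.
⟦or⟧-introˡ : ∀ {P Q : Set} → P → ¬ (¬ P × ¬ Q)
⟦or⟧-introˡ p (¬p , _) = ¬p p

⟦or⟧-introʳ : ∀ {P Q : Set} → Q → ¬ (¬ P × ¬ Q)
⟦or⟧-introʳ q (_ , ¬q) = ¬q q

⟦or⟧-elim : ∀ {P Q C : Set} → Stable C → ¬ (¬ P × ¬ Q) → (P → C) → (Q → C) → C
⟦or⟧-elim stable p∨q f g = stable λ ¬c → p∨q (¬c ∘ f , ¬c ∘ g)

module _ {n k : ℕ} where

  module _ {Π : Assignment n k} {i : ℕ} where

    ⟦iff⟧-stable : ∀ A B → Stable (⟦ iff A B ⟧ᴮ Π i)
    ⟦iff⟧-stable _ _ ¬¬iff =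
      negated-stable (λ ¬⇒ → ¬¬iff (¬⇒ ∘ proj₁)) , negated-stable (λ ¬⇐ → ¬¬iff (¬⇐ ∘ proj₂))

    ⟦iff⟧⇔ : ∀ A B → Stable (⟦ A ⟧ᴮ Π i) → Stable (⟦ B ⟧ᴮ Π i) →
             ⟦ iff A B ⟧ᴮ Π i ⇔ (⟦ A ⟧ᴮ Π i ⇔ ⟦ B ⟧ᴮ Π i)
    ⟦iff⟧⇔ _ _ stableA stableB = mk⇔
      (λ (¬a∧¬b , ¬b∧¬a) → mk⇔ (λ a → stableB λ ¬b → ¬a∧¬b (a , ¬b))
                               (λ b → stableA λ ¬a → ¬b∧¬a (b , ¬a)))
      (λ a⇔b → (λ (a , ¬b) → ¬b (to a⇔b a)) , (λ (b , ¬a) → ¬a (from a⇔b b)))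

    ⟦literal⟧⇔ : ∀ b a x → ⟦ literal b (ap a x) ⟧ᴮ Π i ⇔ (bit (Π x) a i ≡ b)
    ⟦literal⟧⇔ true  _ _ = mk⇔ (λ x → x) (λ x → x)
    ⟦literal⟧⇔ false _ _ = mk⇔ Bool.¬-not Bool.not-¬

    ⟦⋀⟧⇔ : ∀ {m} (f : Fin (suc m) → Body n k) → ⟦ ⋀ f ⟧ᴮ Π i ⇔ (∀ j → ⟦ f j ⟧ᴮ Π i)
    ⟦⋀⟧⇔ {zero}  f = mk⇔ (λ { f0 zero → f0 }) (λ all → all zero)
    ⟦⋀⟧⇔ {suc m} f = mk⇔
      (λ { (f0 , rest) zero → f0 ; (f0 , rest) (suc j) → to (⟦⋀⟧⇔ (f ∘ suc)) rest j })
      (λ all → all zero , from (⟦⋀⟧⇔ (f ∘ suc)) (all ∘ suc))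

    ⟦⋁⟧-intro : ∀ {m} (f : Fin (suc m) → Body n k) j → ⟦ f j ⟧ᴮ Π i → ⟦ ⋁ f ⟧ᴮ Π i
    ⟦⋁⟧-intro {zero}  f zero    fj = fj
    ⟦⋁⟧-intro {suc m} f zero    fj = ⟦or⟧-introˡ fj
    ⟦⋁⟧-intro {suc m} f (suc j) fj = ⟦or⟧-introʳ (⟦⋁⟧-intro (f ∘ suc) j fj)

    ⟦⋁⟧-elim : ∀ {m} (f : Fin (suc m) → Body n k) {C : Set} → Stable C →
               ⟦ ⋁ f ⟧ᴮ Π i → (∀ j → ⟦ f j ⟧ᴮ Π i → C) → C
    ⟦⋁⟧-elim {zero}  f stable f0 g = g zero f0
    ⟦⋁⟧-elim {suc m} f stable fs g =
      ⟦or⟧-elim stable fs (g zero) (λ rest → ⟦⋁⟧-elim (f ∘ suc) stable rest (g ∘ suc))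

  ⟦always⟧⇔ : ∀ {Π : Assignment n k} {i} (A : Body n k) → (∀ j → Stable (⟦ A ⟧ᴮ Π j)) →
              ⟦ always A ⟧ᴮ Π i ⇔ (∀ j → i ≤ j → ⟦ A ⟧ᴮ Π j)
  ⟦always⟧⇔ A stable = mk⇔
    (λ □a j i≤j → stable j λ ¬a → □a (j , i≤j , ¬a , λ _ _ _ (a , ¬a) → ¬a a))
    (λ all (j , i≤j , ¬a , _) → ¬a (all j i≤j))

  firstOf : Fin n → Fin k → Body n k
  firstOf a x = until (neg (ap a x)) (ap a x)

  same incremented decremented : Fin n → Fin k → Fin k → Body n k
  same a y x        = always (iff (ap a y) (ap a x))
  incremented a y x = and (neg (ap a y)) (always (iff (next (ap a y)) (ap a x)))
  decremented a y x = always (iff (ap a y) (next (ap a x)))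

module Registers {n k : ℕ} (Π : Assignment n k) (a : Fin n) where

  private
    always-iff⇔≗ : ∀ A B {f g : ℕ → Bool} →
                   (∀ j → ⟦ A ⟧ᴮ Π j ⇔ (f j ≡ true)) → (∀ j → ⟦ B ⟧ᴮ Π j ⇔ (g j ≡ true)) →
                   ⟦ always (iff A B) ⟧ᴮ Π 0 ⇔ (f ≗ g)
    always-iff⇔≗ A B {f} {g} A⇔f B⇔g = mk⇔
      (λ □iff j → Bool.⇔→≡ (B⇔g j ⇔-∘ (to (⟦iff⟧ j) (to ⟦always-iff⟧ □iff j z≤n) ⇔-∘ ⇔-sym (A⇔f j))))
      (λ f≗g → from ⟦always-iff⟧ λ j _ → from (⟦iff⟧ j) (⇔-sym (B⇔g j) ⇔-∘ (≡⇒⇔ (f≗g j) ⇔-∘ A⇔f j)))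
      where
        stable : ∀ C {h : ℕ → Bool} → (∀ j → ⟦ C ⟧ᴮ Π j ⇔ (h j ≡ true)) → ∀ j → Stable (⟦ C ⟧ᴮ Π j)
        stable C {h} C⇔h j ¬¬c =
          from (C⇔h j) (decidable-stable (h j Bool.≟ true) (¬¬-map (to (C⇔h j)) ¬¬c))

        ⟦iff⟧ : ∀ j → ⟦ iff A B ⟧ᴮ Π j ⇔ (⟦ A ⟧ᴮ Π j ⇔ ⟦ B ⟧ᴮ Π j)
        ⟦iff⟧ j = ⟦iff⟧⇔ A B (stable A A⇔f j) (stable B B⇔g j)

        ⟦always-iff⟧ : ⟦ always (iff A B) ⟧ᴮ Π 0 ⇔ (∀ j → 0 ≤ j → ⟦ iff A B ⟧ᴮ Π j)
        ⟦always-iff⟧ = ⟦always⟧⇔ {Π = Π} (iff A B) (λ j → ⟦iff⟧-stable {Π = Π} {i = j} A B)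

        ≡⇒⇔ : ∀ {p q : Bool} → p ≡ q → (p ≡ true) ⇔ (q ≡ true)
        ≡⇒⇔ p≡q = mk⇔ (trans (sym p≡q)) (trans p≡q)

  ⟦same⟧⇔ : ∀ y x → ⟦ same a y x ⟧ᴮ Π 0 ⇔ (bit (Π y) a ≗ bit (Π x) a)
  ⟦same⟧⇔ y x = always-iff⇔≗ (ap a y) (ap a x) (λ _ → ⇔-id _) (λ _ → ⇔-id _)

  ⟦incremented⟧⇔ : ∀ y x → ⟦ incremented a y x ⟧ᴮ Π 0 ⇔
                           (bit (Π y) a 0 ≢ true × bit (Π y) a ∘ suc ≗ bit (Π x) a)
  ⟦incremented⟧⇔ y x = mk⇔ (λ (y0 , □iff) → y0 , to shifted □iff) (λ (y0 , shift) → y0 , from shifted shift)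
    where
      shifted : ⟦ always (iff (next (ap a y)) (ap a x)) ⟧ᴮ Π 0 ⇔ (bit (Π y) a ∘ suc ≗ bit (Π x) a)
      shifted = always-iff⇔≗ (next (ap a y)) (ap a x) (λ _ → ⇔-id _) (λ _ → ⇔-id _)

  ⟦decremented⟧⇔ : ∀ y x → ⟦ decremented a y x ⟧ᴮ Π 0 ⇔ (bit (Π y) a ≗ bit (Π x) a ∘ suc)
  ⟦decremented⟧⇔ y x = always-iff⇔≗ (ap a y) (next (ap a x)) (λ _ → ⇔-id _) (λ _ → ⇔-id _)

  ⟦firstOf⟧⇔ : ∀ x → ⟦ firstOf a x ⟧ᴮ Π 0 ⇔ ∃ (First (bit (Π x) a))
  ⟦firstOf⟧⇔ x = mk⇔ (λ (j , _ , fj , <j) → j , fj , <j _ z≤n)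
                     (λ (j , fj , <j) → j , z≤n , fj , λ _ _ → <j)

  same-First : ∀ y x {v w} → ⟦ same a y x ⟧ᴮ Π 0 →
               First (bit (Π x) a) v → First (bit (Π y) a) w → w ≡ v
  same-First y x kept fv fw = First-unique fw (First-resp-≗ (sym ∘ to (⟦same⟧⇔ y x) kept) fv)

  incremented-First : ∀ y x {v w} → ⟦ incremented a y x ⟧ᴮ Π 0 →
                      First (bit (Π x) a) v → First (bit (Π y) a) w → w ≡ suc v
  incremented-First y x incr fv fw =
    let (y0 , shift) = to (⟦incremented⟧⇔ y x) incr in First-shift y0 shift fw fv

  decremented-First : ∀ y x {v w} → ⟦ decremented a y x ⟧ᴮ Π 0 → bit (Π x) a 0 ≢ true →
                      First (bit (Π x) a) v → First (bit (Π y) a) w → v ≡ suc w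
  decremented-First y x decr x0 = First-shift x0 (sym ∘ to (⟦decremented⟧⇔ y x) decr)

  unary-firstOf : ∀ x {v} → bit (Π x) a ≗ unary v → ⟦ firstOf a x ⟧ᴮ Π 0
  unary-firstOf x x≗ = from (⟦firstOf⟧⇔ x) (_ , First-resp-≗ (sym ∘ x≗) (First-unary _))

  unary-same : ∀ y x {v} → bit (Π y) a ≗ unary v → bit (Π x) a ≗ unary v → ⟦ same a y x ⟧ᴮ Π 0
  unary-same y x y≗ x≗ = from (⟦same⟧⇔ y x) (λ j → trans (y≗ j) (sym (x≗ j)))

  unary-incremented : ∀ y x {v} → bit (Π y) a ≗ unary (suc v) → bit (Π x) a ≗ unary v →
                      ⟦ incremented a y x ⟧ᴮ Π 0
  unary-incremented y x y≗ x≗ = from (⟦incremented⟧⇔ y x)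
    ((λ y0 → contradiction (trans (sym (y≗ 0)) y0) λ ()) , λ j → trans (y≗ (suc j)) (sym (x≗ j)))

  unary-decremented : ∀ y x {v} → bit (Π y) a ≗ unary v → bit (Π x) a ≗ unary (suc v) →
                      ⟦ decremented a y x ⟧ᴮ Π 0
  unary-decremented y x y≗ x≗ = from (⟦decremented⟧⇔ y x) (λ j → trans (y≗ j) (sym (x≗ (suc j))))

⋖ˢ-mono : ∀ {n} {T T′ : TraceSet n} {U} → T ⊆ T′ → U ⋖ˢ T → U ⋖ˢ T′
⋖ˢ-mono T⊆T′ = All.map (λ (t , t∈T , u⋖t) → t , T⊆T′ t∈T , u⋖t)

unsatisfiable⇒hypersafety : ∀ {n} {H : HyperProperty n} → (∀ T → ¬ H T) → IsHypersafety H
unsatisfiable⇒hypersafety unsatisfiable _ _ = [] , All.[] , λ T′ _ → unsatisfiable T′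

hypersafety⇒subset-closed : ∀ {n} {H : HyperProperty n} → IsHypersafety H →
                            ∀ {T T′} → T ⊆ T′ → H T′ → ¬ ¬ H T
hypersafety⇒subset-closed safe T⊆T′ HT′ ¬HT =
  let (_ , U⋖T , refuted) = safe _ ¬HT in refuted _ (⋖ˢ-mono T⊆T′ U⋖T) HT′

module Reduction (M : Machine) where

  L : ℕ
  L = suc (size M)

  n : ℕ
  n = 4 + L

  counterAP : Fin 2 → Fin n
  counterAP zero    = zero
  counterAP (suc _) = suc zero

  countdownAP flagAP : Fin n
  countdownAP = suc (suc zero)
  flagAP      = suc (suc (suc zero))

  labelAP : Fin L → Fin n
  labelAP l = suc (suc (suc (suc l)))

  -- φ = ∃π₀ ∃πᶠ ∀π ∃π′ Φ, with de Bruijn indices counted from the innermost quantifier.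
  π′ π πᶠ π₀ : Fin 4
  π′ = zero
  π  = suc zero
  πᶠ = suc (suc zero)
  π₀ = suc (suc (suc zero))

  assign : (t₀ tᶠ t t′ : Trace n) → Assignment n 4
  assign t₀ tᶠ t t′ = extend t′ (extend t (extend tᶠ (extend t₀ emptyAssignment)))

  hasLabel : Fin 4 → Fin L → Body n 4
  hasLabel x l = ⋀ λ j → literal (does (j Fin.≟ l)) (ap (labelAP j) x)

  transition : Instr L → Body n 4
  transition (inc c j k) =
    and (or (hasLabel π′ j) (hasLabel π′ k))
        (and (incremented (counterAP c) π′ π) (same (counterAP (otherC c)) π′ π))
  transition (jzdec c j k) =
    or (and (ap (counterAP c) π)
            (and (hasLabel π′ j) (and (same (counterAP c) π′ π) (same (counterAP (otherC c)) π′ π))))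
       (and (neg (ap (counterAP c) π))
            (and (hasLabel π′ k) (and (decremented (counterAP c) π′ π) (same (counterAP (otherC c)) π′ π))))

  stepFrom : Fin L → Body n 4
  stepFrom l = and (hasLabel π l) (transition (lookup (program M) l))

  isInitial isFlagged wellFormed steps countsDown Φ : Body n 4
  isInitial  = and (hasLabel π₀ zero) (and (ap (counterAP zero) π₀) (ap (counterAP (suc zero)) π₀))
  isFlagged  = ap flagAP πᶠ
  wellFormed = and (firstOf (counterAP zero) π) (and (firstOf (counterAP (suc zero)) π) (firstOf countdownAP π))
  steps      = ⋁ stepFrom
  countsDown = or (and (ap countdownAP π) (hasLabel π zero))
                  (and (neg (ap countdownAP π)) (decremented countdownAP π′ π))
  Φ          = and isInitial (and isFlagged (and wellFormed (and steps countsDown)))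

  φ : Closed n
  φ = ∃π (∃π (∀π (∃π (body Φ))))

  ⟦hasLabel⟧⇔ : ∀ {Π i} x l → ⟦ hasLabel x l ⟧ᴮ Π i ⇔ (∀ j → bit (Π x) (labelAP j) i ≡ does (j Fin.≟ l))
  ⟦hasLabel⟧⇔ x l = mk⇔ (λ h j → to (⟦literal⟧⇔ _ _ x) (to (⟦⋀⟧⇔ _) h j))
                        (λ h → from (⟦⋀⟧⇔ _) λ j → from (⟦literal⟧⇔ _ _ x) (h j))

  labelOf : Trace n → Fin L
  labelOf t with any? (λ j → bit t (labelAP j) 0 Bool.≟ true)
  ... | yes (l , _) = l
  ... | no _        = zero

  labelOf-oneHot : ∀ {t l} → (∀ j → bit t (labelAP j) 0 ≡ does (j Fin.≟ l)) → labelOf t ≡ l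
  labelOf-oneHot {t} {l} oneHot with any? (λ j → bit t (labelAP j) 0 Bool.≟ true)
  ... | no none = contradiction (l , trans (oneHot l) (dec-true (l Fin.≟ l) refl)) none
  ... | yes (j , tj) with j Fin.≟ l | trans (sym (oneHot j)) tj
  ...   | yes j≡l | _ = j≡l
  ...   | no _    | ()

  labelOf-hasLabel : ∀ {Π} x l → ⟦ hasLabel x l ⟧ᴮ Π 0 → labelOf (Π x) ≡ l
  labelOf-hasLabel {Π} x l = labelOf-oneHot {Π x} ∘ to (⟦hasLabel⟧⇔ x l)

  Encodes : Trace n → Counters → Set
  Encodes t cs = ∀ c → First (bit t (counterAP c)) (getC c cs)

  module _ {Π : Assignment n 4} where

    open Registers Π

    countsDown-sound : ∀ {d d′} → First (bit (Π π) countdownAP) d → First (bit (Π π′) countdownAP) d′ →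
                       ⟦ countsDown ⟧ᴮ Π 0 → CountsDown (labelOf (Π π) ≡ zero) d d′
    countsDown-sound {d} {d′} dπ dπ′ counting =
      ⟦or⟧-elim (decidable-stable (CountsDown? (labelOf (Π π) Fin.≟ zero) d d′)) counting
        (λ (d0 , isZero) → subst (λ d → CountsDown _ d d′) (First-unique (First-zero d0) dπ)
                                 (labelOf-hasLabel {Π} π zero isZero))
        (λ (d≢0 , decr) → subst (λ d → CountsDown _ d d′)
                                (sym (decremented-First countdownAP π′ π decr d≢0 dπ dπ′)) refl)

    module _ {cs cs′ : Counters} (csπ : Encodes (Π π) cs) (csπ′ : Encodes (Π π′) cs′) where

      private
        kept : ∀ c → ⟦ same (counterAP c) π′ π ⟧ᴮ Π 0 → getC c cs′ ≡ getC c cs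
        kept c s = same-First (counterAP c) π′ π s (csπ c) (csπ′ c)

        arrive : ∀ {ins a l cs″} → ⟦ hasLabel π′ l ⟧ᴮ Π 0 → cs′ ≡ cs″ →
                 StepI ins a (l , cs″) → StepI ins a (labelOf (Π π′) , cs′)
        arrive {l = l} isl refl = subst (λ l′ → StepI _ _ (l′ , _)) (sym (labelOf-hasLabel {Π} π′ l isl))

      transition-sound : ∀ ins {l} → ⟦ transition ins ⟧ᴮ Π 0 → StepI ins (l , cs) (labelOf (Π π′) , cs′)
      transition-sound (inc c j k) (j∨k , incr , keptOther) =
        ⟦or⟧-elim (StepI-stable _ _ _) j∨k (λ isj → arrive isj cs′≡ inc-j) (λ isk → arrive isk cs′≡ inc-k)
        where
          cs′≡ : cs′ ≡ setC c (suc (getC c cs)) cs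
          cs′≡ = setC-unique c (incremented-First (counterAP c) π′ π incr (csπ c) (csπ′ c))
                               (kept (otherC c) keptOther)
      transition-sound (jzdec c j k) branch =
        ⟦or⟧-elim (StepI-stable _ _ _) branch
          (λ (c0 , isj , keptC , keptOther) →
             arrive isj (getC-ext c (kept c keptC) (kept (otherC c) keptOther))
                    (jz (First-unique (csπ c) (First-zero c0))))
          (λ (c≢0 , isk , decr , keptOther) →
             arrive isk (setC-unique c refl (kept (otherC c) keptOther))
                    (dec (decremented-First (counterAP c) π′ π decr c≢0 (csπ c) (csπ′ c))))

      steps-sound : ⟦ steps ⟧ᴮ Π 0 → Step M (labelOf (Π π) , cs) (labelOf (Π π′) , cs′)
      steps-sound stepping = ⟦⋁⟧-elim stepFrom (StepI-stable _ _ _) stepping λ l (isl , tr) →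
        subst (λ l → Step M (l , cs) _) (sym (labelOf-hasLabel {Π} π l isl)) (transition-sound _ tr)

  module Model {T : TraceSet n} {t₀ tᶠ : Trace n} (t₀∈T : T t₀)
               (successor : ∀ t → T t → Σ (Trace n) λ t′ → T t′ × ⟦ Φ ⟧ᴮ (assign t₀ tᶠ t t′) 0) where

    run : ℕ → Σ (Trace n) T
    run zero    = t₀ , t₀∈T
    run (suc i) = let (t′ , t′∈T , _) = successor (proj₁ (run i)) (proj₂ (run i)) in t′ , t′∈T

    trace : ℕ → Trace n
    trace i = proj₁ (run i)

    holds : ∀ i → ⟦ Φ ⟧ᴮ (assign t₀ tᶠ (trace i) (trace (suc i))) 0
    holds i = proj₂ (proj₂ (successor (trace i) (proj₂ (run i))))

    registers : ∀ i → ∃ (First (bit (trace i) (counterAP zero))) × ∃ (First (bit (trace i) (counterAP (suc zero))))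
                      × ∃ (First (bit (trace i) countdownAP))
    registers i = let (_ , _ , (c₀ , c₁ , d) , _) = holds i
                      open Registers (assign t₀ tᶠ (trace i) (trace (suc i)))
                  in to (⟦firstOf⟧⇔ _ π) c₀ , to (⟦firstOf⟧⇔ _ π) c₁ , to (⟦firstOf⟧⇔ _ π) d

    counters : ℕ → Counters
    counters i = let (c₀ , c₁ , _) = registers i in proj₁ c₀ , proj₁ c₁

    encodes : ∀ i → Encodes (trace i) (counters i)
    encodes i zero    = let (c₀ , _ , _) = registers i in proj₂ c₀
    encodes i (suc _) = let (_ , c₁ , _) = registers i in proj₂ c₁

    countdown : ℕ → ℕ
    countdown i = let (_ , _ , d) = registers i in proj₁ d

    countdown-First : ∀ i → First (bit (trace i) countdownAP) (countdown i)
    countdown-First i = let (_ , _ , d) = registers i in proj₂ d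

    config : ℕ → Config M
    config i = labelOf (trace i) , counters i

    starts : config 0 ≡ initial M
    starts = let (isl , c₀ , c₁) = proj₁ (holds 0) in
      cong₂ _,_ (labelOf-hasLabel π₀ zero isl)
                (cong₂ _,_ (First-unique (encodes 0 zero) (First-zero c₀))
                           (First-unique (encodes 0 (suc zero)) (First-zero c₁)))

    moves : ∀ i → Step M (config i) (config (suc i))
    moves i = let (_ , _ , _ , stepping , _) = holds i in steps-sound (encodes i) (encodes (suc i)) stepping

    counts : Countdown (λ i → proj₁ (config i) ≡ zero) countdown
    counts i = let (_ , _ , _ , _ , counting) = holds i in
      countsDown-sound (countdown-First i) (countdown-First (suc i)) counting

    recurring : Recurring M
    recurring = config , starts , moves , countdown⇒infinitelyOften counts

  model⇒recurring : ∀ {T} → T ⊨ φ → Recurring M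
  model⇒recurring (_ , t₀∈T , _ , _ , successor) = Model.recurring t₀∈T successor

  model⇒flagged : ∀ {T} → T ⊨ φ → ∃ λ t → T t × bit t flagAP 0 ≡ true
  model⇒flagged (t₀ , t₀∈T , tᶠ , tᶠ∈T , successor) =
    let (_ , _ , _ , flagged , _) = successor t₀ t₀∈T in tᶠ , tᶠ∈T , flagged

  module _ {Π : Assignment n 4} where

    open Registers Π

    countsDown-complete : ∀ {l} d {d′} → ⟦ hasLabel π l ⟧ᴮ Π 0 →
                          bit (Π π) countdownAP ≗ unary d → bit (Π π′) countdownAP ≗ unary d′ →
                          CountsDown (l ≡ zero) d d′ → ⟦ countsDown ⟧ᴮ Π 0
    countsDown-complete zero    isl dπ _   refl = ⟦or⟧-introˡ (dπ 0 , isl)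
    countsDown-complete (suc d) _   dπ dπ′ refl =
      ⟦or⟧-introʳ ((λ d0 → contradiction (trans (sym (dπ 0)) d0) λ ()) ,
                   unary-decremented countdownAP π′ π dπ′ dπ)

    module _ {l l′ : Fin L} {cs cs′ : Counters}
             (countersπ : ∀ c → bit (Π π) (counterAP c) ≗ unary (getC c cs))
             (countersπ′ : ∀ c → bit (Π π′) (counterAP c) ≗ unary (getC c cs′))
             (labelπ′ : ⟦ hasLabel π′ l′ ⟧ᴮ Π 0) where

      private
        π-counter : ∀ c {v} → getC c cs ≡ v → bit (Π π) (counterAP c) ≗ unary v
        π-counter c refl = countersπ c

        π′-counter : ∀ c {v} → getC c cs′ ≡ v → bit (Π π′) (counterAP c) ≗ unary v
        π′-counter c refl = countersπ′ c

        keeps : ∀ c → getC c cs′ ≡ getC c cs → ⟦ same (counterAP c) π′ π ⟧ᴮ Π 0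
        keeps c cs′≡cs = unary-same (counterAP c) π′ π (π′-counter c cs′≡cs) (countersπ c)

      transition-complete : ∀ {ins} → StepI ins (l , cs) (l′ , cs′) → ⟦ transition ins ⟧ᴮ Π 0
      transition-complete (inc-j {c = c}) =
        ⟦or⟧-introˡ labelπ′ ,
        unary-incremented (counterAP c) π′ π (π′-counter c (getC-setC c _ cs)) (countersπ c) ,
        keeps (otherC c) (getC-otherC-setC c _ cs)
      transition-complete (inc-k {c = c}) =
        ⟦or⟧-introʳ labelπ′ ,
        unary-incremented (counterAP c) π′ π (π′-counter c (getC-setC c _ cs)) (countersπ c) ,
        keeps (otherC c) (getC-otherC-setC c _ cs)
      transition-complete (jz {c = c} c≡0) =
        ⟦or⟧-introˡ (π-counter c c≡0 0 , labelπ′ , keeps c refl , keeps (otherC c) refl)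
      transition-complete (dec {c = c} {v = v} c≡1+v) =
        ⟦or⟧-introʳ ((λ c0 → contradiction (trans (sym (π-counter c c≡1+v 0)) c0) λ ()) , labelπ′ ,
                     unary-decremented (counterAP c) π′ π (π′-counter c (getC-setC c v cs)) (π-counter c c≡1+v) ,
                     keeps (otherC c) (getC-otherC-setC c v cs))

      steps-complete : ⟦ hasLabel π l ⟧ᴮ Π 0 → Step M (l , cs) (l′ , cs′) → ⟦ steps ⟧ᴮ Π 0
      steps-complete labelπ step = ⟦⋁⟧-intro stepFrom l (labelπ , transition-complete step)

  encode : Bool → Config M → ℕ → Trace n
  encode b (l , (x , y)) d i = unary x i ∷ unary y i ∷ unary d i ∷ b ∷ tabulate (λ j → does (j Fin.≟ l))

  encode-counter : ∀ {b l cs d} c → bit (encode b (l , cs) d) (counterAP c) ≗ unary (getC c cs)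
  encode-counter zero    _ = refl
  encode-counter (suc _) _ = refl

  encode-hasLabel : ∀ {Π : Assignment n 4} x {b l cs d} → Π x ≡ encode b (l , cs) d → ⟦ hasLabel x l ⟧ᴮ Π 0
  encode-hasLabel {Π} x {l = l} Πx≡ = from (⟦hasLabel⟧⇔ {Π} x l) λ j →
    subst (λ t → bit t (labelAP j) 0 ≡ does (j Fin.≟ l)) (sym Πx≡) (lookup∘tabulate (λ j → does (j Fin.≟ l)) j)

  Φ-complete : ∀ {cfg₀ d₀ b l cs d l′ cs′ d′} tᶠ → bit tᶠ flagAP 0 ≡ true → cfg₀ ≡ initial M →
               Step M (l , cs) (l′ , cs′) → CountsDown (l ≡ zero) d d′ →
               ⟦ Φ ⟧ᴮ (assign (encode false cfg₀ d₀) tᶠ (encode b (l , cs) d) (encode false (l′ , cs′) d′)) 0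
  Φ-complete {d₀ = d₀} {b} {l} {cs} {d} {l′} {cs′} {d′} tᶠ flagged refl step counting =
    (encode-hasLabel π₀ refl , refl , refl) ,
    flagged ,
    (unary-firstOf (counterAP zero) π (countersπ zero) ,
     unary-firstOf (counterAP (suc zero)) π (countersπ (suc zero)) ,
     unary-firstOf countdownAP π (λ _ → refl)) ,
    steps-complete {Π} countersπ countersπ′ labelπ′ labelπ step ,
    countsDown-complete {Π} d labelπ (λ _ → refl) (λ _ → refl) counting
    where
      Π : Assignment n 4
      Π = assign (encode false (initial M) d₀) tᶠ (encode b (l , cs) d) (encode false (l′ , cs′) d′)

      open Registers Π

      labelπ : ⟦ hasLabel π l ⟧ᴮ Π 0
      labelπ = encode-hasLabel π refl

      labelπ′ : ⟦ hasLabel π′ l′ ⟧ᴮ Π 0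
      labelπ′ = encode-hasLabel π′ refl

      countersπ : ∀ c → bit (Π π) (counterAP c) ≗ unary (getC c cs)
      countersπ = encode-counter {b} {l} {cs} {d}

      countersπ′ : ∀ c → bit (Π π′) (counterAP c) ≗ unary (getC c cs′)
      countersπ′ = encode-counter {false} {l′} {cs′} {d′}

  module Witness {r : ℕ → Config M} (r₀ : r 0 ≡ initial M) (moves : ∀ i → Step M (r i) (r (suc i)))
                 (often : InfinitelyOften (λ i → proj₁ (r i) ≡ zero)) where

    countdown : ℕ → ℕ
    countdown = proj₁ (infinitelyOften⇒countdown often)

    counts : Countdown (λ i → proj₁ (r i) ≡ zero) countdown
    counts = proj₂ (infinitelyOften⇒countdown often)

    τ : Bool → ℕ → Trace n
    τ b i = encode b (r i) (countdown i)

    runTraces : TraceSet n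
    runTraces t = ∃ λ i → τ false i ≡ t

    flaggedRun : TraceSet n
    flaggedRun = runTraces ∪ ｛ τ true 0 ｝

    runTraces⊭φ : ¬ (runTraces ⊨ φ)
    runTraces⊭φ model with model⇒flagged model
    ... | _ , (_ , refl) , ()

    flaggedRun⊨φ : flaggedRun ⊨ φ
    flaggedRun⊨φ = τ false 0 , inj₁ (0 , refl) , τ true 0 , inj₂ refl , successor
      where
        successor : ∀ t → flaggedRun t →
                    Σ (Trace n) λ t′ → flaggedRun t′ × ⟦ Φ ⟧ᴮ (assign (τ false 0) (τ true 0) t t′) 0
        successor _ (inj₁ (i , refl)) =
          τ false (suc i) , inj₁ (suc i , refl) , Φ-complete (τ true 0) refl r₀ (moves i) (counts i)
        successor _ (inj₂ refl) =
          τ false 1 , inj₁ (1 , refl) , Φ-complete (τ true 0) refl r₀ (moves 0) (counts 0)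

reduction : Machine → HyperLTLFormula
reduction M = Reduction.n M , Reduction.φ M

proposition3p1 : Π¹₁-hard DefinesHypersafety
proposition3p1 = reduction , λ M → let open Reduction M in
  (λ nonRecurring → unsatisfiable⇒hypersafety λ _ model → nonRecurring (model⇒recurring model)) ,
  (λ { safe (_ , r₀ , moves , often) → let open Witness r₀ moves often in
         hypersafety⇒subset-closed safe inj₁ flaggedRun⊨φ runTraces⊭φ })
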